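{- For $n\ge 0$ let \[ a_n:=\sum_{k=0}^n\binom{n}{k}^2\binom{2k}{n}^2 . \] Then the ordinary power series generating function $A(x)=\sum_{n\ge 0}a_nx^n$ of $\{a_n\}_{n\ge 0}$ has a square root with integer coefficients; that is, there exists a formal power series $B(x)=\sum_{n\ge 0}b_nx^n$ with all $b_n\in\mathbb{Z}$ such that $B(x)^2=A(x)$.
   Context: For non-negative integers $a,b$, $\binom{a}{b}=0$ if $b>a$. -}

module Defs where

open import Data.Fin.Base using (toℕ)
open import Data.Integer.Base as ℤ using (ℤ; +_)
open import Data.Integer.Properties using () renaming (+-*-semiring to ℤ-semiring)
open import Data.Nat.Base using (ℕ; _+_; _*_; _^_; _∸_)
open import Data.Nat.Combinatorics using (_C_)
open import Data.Nat.Properties using () renaming (+-*-semiring to ℕ-semiring)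
open import Relation.Binary.PropositionalEquality using (_≗_)

import Algebra.Properties.Semiring.Sum ℕ-semiring as ℕ-Sum
import Algebra.Properties.Semiring.Sum ℤ-semiring as ℤ-Sum

-- The index ranges over k : Fin (suc n), that is, 0 ≤ toℕ k ≤ n.
-- The library's m C j is 0 when j > m.
a : ℕ → ℕ
a n = ∑[ k ≤ n ] ((n C toℕ k) ^ 2 * ((2 * toℕ k) C n) ^ 2)
  where open ℕ-Sum using (sum⁺-syntax)

-- Formal power series over ℤ, represented by the sequence of coefficients.
PowerSeries : Set
PowerSeries = ℕ → ℤ

-- Coefficientwise: function extensionality is not available.
infix 4 _≈_
_≈_ : PowerSeries → PowerSeries → Set
_≈_ = _≗_

-- Cauchy product.
infixl 7 _⊛_
_⊛_ : PowerSeries → PowerSeries → PowerSeries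
(F ⊛ G) n = ∑[ i ≤ n ] (F (toℕ i) ℤ.* G (n ∸ toℕ i))
  where open ℤ-Sum using (sum⁺-syntax)

A : PowerSeries
A n = + a n

{-# OPTIONS --safe #-}
module Submission where

open import Defs
open import Data.Product using (Σ-syntax)

open import Data.Fin.Base as Fin using (toℕ)
open import Data.Fin.Properties using (toℕ<n; toℕ≤pred[n]; toℕ-fromℕ; toℕ-inject₁)
open import Data.Integer.Base as ℤ using (ℤ; +_)
import Data.Integer.Divisibility.Signed as ℤ∣
import Data.Integer.Properties as ℤₚ
import Data.Integer.Solver as ℤ-Solver
open import Data.Nat.Base
open import Data.Nat.Combinatorics using (_C_; nCk≡n!/k![n-k]!; k![n∸k]!∣n!;
  nCk≡nC[n∸k]; nCk+nC[k+1]≡[n+1]C[k+1]; k>n⇒nCk≡0)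
open import Data.Nat.Divisibility using (_∣_; divides; _∣0; ∣m∣n⇒∣m+n; ∣m⇒∣m*n; *-pres-∣)
open import Data.Nat.DivMod using (m/n*n≡m)
open import Data.Nat.Induction using (<-rec; <-wellFounded)
open import Data.Nat.Properties
import Data.Nat.Solver as ℕ-Solver
open import Data.Product using (_,_; proj₁; proj₂; _×_)
open import Data.Vec.Functional using (Vector)
open import Function.Base using (_∘_)
open import Induction.WellFounded using (WfRec; module FixPoint)
open import Relation.Binary.PropositionalEquality
  using (_≡_; refl; sym; trans; cong; cong₂; subst; module ≡-Reasoning)
open import Relation.Nullary.Decidable using (yes; no)

import Algebra.Properties.Semiring.Sum +-*-semiring as ℕ-Sum
import Algebra.Properties.Semiring.Sum ℤₚ.+-*-semiring as ℤ-Sum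

-- Why the theorem holds.  By trinomial revision, for k ≤ n ≤ 2k,
--
--   (2k C n) (n C k) = (2k C k) (k C (n - k)),
--
-- and the central binomial coefficient 2k C k is even for k ≥ 1, being twice
-- (2k - 1) C (k - 1).  If n > 2k the factor 2k C n vanishes, so for n ≥ 1
-- every summand of a n is the square of an even number, and 4 divides a n.
-- As a 0 = 1, this gives A = 1 + 4x G with G an integer power series.
--
-- Any such series is a square (one-plus-four-is-square): with B = 1 + 2x E,
-- the equation B² = 1 + 4x G says E + x E² = G, that is,
--
--   E 0 = G 0,   E (n + 1) = G (n + 1) - (E²) n,
--
-- which determines integers E n recursively (quadratic-recursion), since the
-- coefficient (E²) n involves only E 0, ..., E n.

[i+j]Ci*i!j!≡[i+j]! : ∀ i j → ((i + j) C i) * (i ! * j !) ≡ (i + j) !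
[i+j]Ci*i!j!≡[i+j]! i j = subst (λ l → ((i + j) C i) * (i ! * l !) ≡ (i + j) !)
  (m+n∸m≡n i j)
  (trans (cong (_* (i ! * (i + j ∸ i) !)) (nCk≡n!/k![n-k]! (m≤m+n i j)))
         (m/n*n≡m (k![n∸k]!∣n! (m≤m+n i j))))
  where instance _ = i !* (i + j ∸ i) !≢0

-- Both sides, when multiplied by i! j! l!, give (i + j + l)!.
trinomial-revision : ∀ i j l →
  ((i + j + l) C (i + j)) * ((i + j) C i) ≡ ((i + (j + l)) C i) * ((j + l) C j)
trinomial-revision i j l = *-cancelʳ-≡ _ _ (i ! * j ! * l !) (begin
  P * Q * (i ! * j ! * l !)     ≡⟨ solve 5 (λ p q x y z → p :* q :* (x :* y :* z) := p :* (q :* (x :* y) :* z))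
                                     refl P Q (i !) (j !) (l !) ⟩
  P * (Q * (i ! * j !) * l !)   ≡⟨ cong (λ t → P * (t * l !)) ([i+j]Ci*i!j!≡[i+j]! i j) ⟩
  P * ((i + j) ! * l !)         ≡⟨ [i+j]Ci*i!j!≡[i+j]! (i + j) l ⟩
  (i + j + l) !                 ≡⟨ cong _! (+-assoc i j l) ⟩
  (i + (j + l)) !               ≡⟨ [i+j]Ci*i!j!≡[i+j]! i (j + l) ⟨
  R * (i ! * (j + l) !)         ≡⟨ cong (λ t → R * (i ! * t)) ([i+j]Ci*i!j!≡[i+j]! j l) ⟨
  R * (i ! * (S * (j ! * l !))) ≡⟨ solve 5 (λ r s x y z → r :* (x :* (s :* (y :* z))) := r :* s :* (x :* y :* z))
                                     refl R S (i !) (j !) (l !) ⟩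
  R * S * (i ! * j ! * l !)     ∎)
  where
  open ≡-Reasoning
  open ℕ-Solver.+-*-Solver
  P = (i + j + l) C (i + j)
  Q = (i + j) C i
  R = (i + (j + l)) C i
  S = (j + l) C j
  instance
    _ = i !* j !≢0
    _ = l !≢0
    _ = m*n≢0 (i ! * j !) (l !)

-- The two Pascal summands (2k + 1) C k and (2k + 1) C (k + 1) are equal by
-- symmetry.
central-even : ∀ k → 2 ∣ (suc k + suc k) C suc k
central-even k = divides (m C k) (begin
  suc m C suc k         ≡⟨ nCk+nC[k+1]≡[n+1]C[k+1] m k ⟨
  m C k + m C suc k     ≡⟨ cong (λ t → m C k + m C t) (m+n∸m≡n k (suc k)) ⟨
  m C k + m C (m ∸ k)   ≡⟨ cong (λ t → m C k + t) (nCk≡nC[n∸k] (m≤m+n k (suc k))) ⟨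
  m C k + m C k         ≡⟨ cong (λ t → m C k + t) (+-identityʳ (m C k)) ⟨
  2 * (m C k)           ≡⟨ *-comm 2 (m C k) ⟩
  (m C k) * 2           ∎)
  where
  open ≡-Reasoning
  m = k + suc k

-- For 1 ≤ k ≤ n ≤ 2k, writing n = k + j and k = j + l turns the product into
-- (2k C k) (k C j).  For k = 0 or n > 2k the factor 2k C n is 0.
nCk*2kCn-even : ∀ {n} k → k ≤ n → 1 ≤ n → 2 ∣ (n C k) * ((2 * k) C n)
nCk*2kCn-even {n} k k≤n 1≤n with n ≤? 2 * k
... | no n≰2k = subst (λ t → 2 ∣ (n C k) * t) (sym (k>n⇒nCk≡0 (≰⇒> n≰2k)))
                  (subst (2 ∣_) (sym (*-zeroʳ (n C k))) (2 ∣0))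
nCk*2kCn-even {suc n} zero    _   _ | yes ()
nCk*2kCn-even {n}     (suc k) k<n _ | yes n≤2k
  with j , refl ← m≤n⇒∃[o]m+o≡n k<n
  with l , j+l≡K ← m≤n⇒∃[o]m+o≡n (+-cancelˡ-≤ (suc k) j (suc k)
                     (subst (λ t → suc k + j ≤ suc k + t) (+-identityʳ (suc k)) n≤2k))
  = subst (2 ∣_) (begin
      ((K + K) C K) * (K C j)                   ≡⟨ cong (λ t → ((K + t) C K) * (t C j)) j+l≡K ⟨
      ((K + (j + l)) C K) * ((j + l) C j)       ≡⟨ trinomial-revision K j l ⟨
      ((K + j + l) C (K + j)) * ((K + j) C K)   ≡⟨ *-comm _ ((K + j) C K) ⟩
      ((K + j) C K) * ((K + j + l) C (K + j))   ≡⟨ cong (λ t → ((K + j) C K) * (t C (K + j))) K+j+l≡2K ⟩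
      ((K + j) C K) * ((2 * K) C (K + j))       ∎)
    (∣m⇒∣m*n (K C j) (central-even k))
  where
  open ≡-Reasoning
  K = suc k
  K+j+l≡2K : K + j + l ≡ 2 * K
  K+j+l≡2K = begin
    K + j + l    ≡⟨ +-assoc K j l ⟩
    K + (j + l)  ≡⟨ cong (λ t → K + t) (trans j+l≡K (sym (+-identityʳ K))) ⟩
    2 * K        ∎

∣-sum : ∀ {d n} (t : Vector ℕ n) → (∀ i → d ∣ t i) → d ∣ ℕ-Sum.sum t
∣-sum {d} {zero}  t d∣t = d ∣0
∣-sum {d} {suc n} t d∣t = ∣m∣n⇒∣m+n (d∣t _) (∣-sum (t ∘ Fin.suc) (d∣t ∘ Fin.suc))

4∣a[1+n] : ∀ n → 4 ∣ a (suc n)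
4∣a[1+n] n = ∣-sum _ (λ k →
  subst (4 ∣_) (square-* (suc n C toℕ k) ((2 * toℕ k) C suc n))
    (square-even (nCk*2kCn-even (toℕ k) (toℕ≤pred[n] k) (s≤s z≤n))))
  where
  square-even : ∀ {x} → 2 ∣ x → 4 ∣ x ^ 2
  square-even 2∣x = *-pres-∣ 2∣x (∣m⇒∣m*n 1 2∣x)

  square-* : ∀ x y → (x * y) ^ 2 ≡ x ^ 2 * y ^ 2
  square-* = solve 2 (λ x y → (x :* y) :^ 2 := x :^ 2 :* y :^ 2) refl
    where open ℕ-Solver.+-*-Solver

-- Separates the two extreme terms of a Cauchy product.
⊛-ends : (F G : PowerSeries) → ∀ n → (F ⊛ G) (2 + n) ≡
         F 0 ℤ.* G (2 + n) ℤ.+ (((F ∘ suc) ⊛ (G ∘ suc)) n ℤ.+ F (2 + n) ℤ.* G 0)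
⊛-ends F G n = cong (λ t → F 0 ℤ.* G (2 + n) ℤ.+ t) (trans
  (ℤ-Sum.sum-init-last {suc n} (λ i → F (suc (toℕ i)) ℤ.* G (suc n ∸ toℕ i)))
  (cong₂ ℤ._+_
    (ℤ-Sum.sum-cong-≗ {n = suc n} (λ i → cong₂ (λ p q → F (suc p) ℤ.* G q) (toℕ-inject₁ i)
      (trans (cong (suc n ∸_) (toℕ-inject₁ i)) (+-∸-assoc 1 (toℕ≤pred[n] i)))))
    (cong₂ (λ p q → F (suc p) ℤ.* G q) (toℕ-fromℕ (suc n))
      (trans (cong (suc n ∸_) (toℕ-fromℕ (suc n))) (n∸n≡0 (suc n))))))

⊛-scale : ∀ c (F : PowerSeries) n → ((λ i → c ℤ.* F i) ⊛ (λ i → c ℤ.* F i)) n ≡ c ℤ.* c ℤ.* (F ⊛ F) n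
⊛-scale c F n = trans
  (ℤ-Sum.sum-cong-≗ {n = suc n} (λ i →
    solve 3 (λ c x y → c :* x :* (c :* y) := c :* c :* (x :* y)) refl
      c (F (toℕ i)) (F (n ∸ toℕ i))))
  (sym (ℤ-Sum.*-distribˡ-sum {suc n} (c ℤ.* c) (λ i → F (toℕ i) ℤ.* F (n ∸ toℕ i))))
  where open ℤ-Solver.+-*-Solver

-- The solution E of E 0 = G 0 and E (n + 1) = G (n + 1) - (E²) n, that is,
-- of E + x E² = G, by course-of-values recursion.
quadratic-recursion : (G : PowerSeries) → Σ[ E ∈ PowerSeries ]
  (E 0 ≡ G 0 × (∀ n → E (suc n) ≡ G (suc n) ℤ.- (E ⊛ E) n))
quadratic-recursion G = E , unfold-wfRec {0} , λ n → unfold-wfRec {suc n}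
  where
  step : ∀ n → WfRec _<_ (λ _ → ℤ) n → ℤ
  step zero    _  = G 0
  step (suc n) IH = G (suc n) ℤ.-
    ∑[ i ≤ n ] (IH (toℕ<n i) ℤ.* IH (s≤s (m∸n≤m n (toℕ i))))
    where open ℤ-Sum using (sum⁺-syntax)

  step-ext : ∀ n {IH IH′ : WfRec _<_ (λ _ → ℤ) n} →
             (∀ {m} (m<n : m < n) → IH m<n ≡ IH′ m<n) → step n IH ≡ step n IH′
  step-ext zero    _  = refl
  step-ext (suc n) eq = cong (λ t → G (suc n) ℤ.- t)
    (ℤ-Sum.sum-cong-≗ {n = suc n} (λ i → cong₂ ℤ._*_ (eq (toℕ<n i)) (eq (s≤s (m∸n≤m n (toℕ i))))))

  open FixPoint <-wellFounded (λ _ → ℤ) step step-ext using (unfold-wfRec)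

  E : PowerSeries
  E = <-rec (λ _ → ℤ) step

one-plus-four-is-square : (F : PowerSeries) → F 0 ≡ + 1 → (∀ n → + 4 ℤ∣.∣ F (suc n)) →
                          Σ[ B ∈ PowerSeries ] (B ⊛ B ≈ F)
one-plus-four-is-square F F0≡1 4∣F = B , B²≈F
  where
  open ≡-Reasoning
  open ℤ-Solver.+-*-Solver

  -- F = 1 + 4x G
  G : PowerSeries
  G n = ℤ∣.quotient (4∣F n)

  F≡G*4 : ∀ n → F (suc n) ≡ G n ℤ.* + 4
  F≡G*4 n = ℤ∣._∣_.equality (4∣F n)

  E : PowerSeries
  E = proj₁ (quadratic-recursion G)

  E0≡G0 : E 0 ≡ G 0
  E0≡G0 = proj₁ (proj₂ (quadratic-recursion G))

  E-suc : ∀ n → E (suc n) ≡ G (suc n) ℤ.- (E ⊛ E) n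
  E-suc = proj₂ (proj₂ (quadratic-recursion G))

  -- B = 1 + 2x E
  B : PowerSeries
  B zero    = + 1
  B (suc n) = + 2 ℤ.* E n

  B²≈F : B ⊛ B ≈ F
  B²≈F zero = sym F0≡1
  B²≈F (suc zero) = begin
    (B ⊛ B) 1     ≡⟨ solve 1 (λ e → con (+ 1) :* (con (+ 2) :* e) :+
                             (con (+ 2) :* e :* con (+ 1) :+ con (+ 0))
                             := e :* con (+ 4)) refl (E 0) ⟩
    E 0 ℤ.* + 4   ≡⟨ cong (ℤ._* + 4) E0≡G0 ⟩
    G 0 ℤ.* + 4   ≡⟨ F≡G*4 0 ⟨
    F 1           ∎
  B²≈F (suc (suc n)) = begin
    (B ⊛ B) (2 + n)
      ≡⟨ ⊛-ends B B n ⟩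
    + 1 ℤ.* (+ 2 ℤ.* E (suc n)) ℤ.+ (((B ∘ suc) ⊛ (B ∘ suc)) n ℤ.+ + 2 ℤ.* E (suc n) ℤ.* + 1)
      ≡⟨ cong₂ (λ e s → + 1 ℤ.* (+ 2 ℤ.* e) ℤ.+ (s ℤ.+ + 2 ℤ.* e ℤ.* + 1))
               (E-suc n) (⊛-scale (+ 2) E n) ⟩
    + 1 ℤ.* (+ 2 ℤ.* (g ℤ.- q)) ℤ.+ (+ 4 ℤ.* q ℤ.+ + 2 ℤ.* (g ℤ.- q) ℤ.* + 1)
      ≡⟨ solve 2 (λ g q → con (+ 1) :* (con (+ 2) :* (g :- q)) :+
                           (con (+ 4) :* q :+ con (+ 2) :* (g :- q) :* con (+ 1))
                           := g :* con (+ 4)) refl g q ⟩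
    g ℤ.* + 4
      ≡⟨ F≡G*4 (suc n) ⟨
    F (2 + n)
      ∎
    where
    g = G (suc n)
    q = (E ⊛ E) n

theorem6p2 : Σ[ B ∈ PowerSeries ] (B ⊛ B ≈ A)
theorem6p2 = one-plus-four-is-square A refl (λ n → ℤ∣.∣ᵤ⇒∣ (4∣a[1+n] n))
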